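{- For each integer $t$, there is a bipartite graph $G$ such that $dis[G]>t$.
   Context: All graphs are finite, undirected, without loops or multiple edges. For a vertex $v$ of a graph $G$, $N[v]$ denotes the closed neighborhood of $v$ (i.e. $v$ together with its neighbors). A labeling $f$ of $V(G)$ by numbers is closed distinguishing if for any two adjacent vertices $u,v$ with $N[u]\neq N[v]$ we have $\sum_{w\in N[u]} f(w)\neq \sum_{w\in N[v]} f(w)$. The closed distinguishing number $dis[G]$ is the smallest positive integer $k$ such that $G$ has a closed distinguishing labeling $f:V(G)\to\{1,2,\ldots,k\}$. -}

module Defs where

open import Algebra.Properties.CommutativeMonoid.Sum using (sum)
open import Data.Bool using (Bool; if_then_else_)
open import Data.Fin using (Fin)
open import Data.Fin.Properties using (_≟_)
open import Data.Fin.Subset using (Subset)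
open import Data.Nat using (ℕ; _≤_)
open import Data.Nat.Properties using (+-0-commutativeMonoid)
open import Data.Product using (Σ-syntax; _×_)
open import Data.Vec using (lookup; tabulate)
open import Level using (0ℓ)
open import Relation.Binary.Core using (Rel)
open import Relation.Binary.Definitions using (Decidable; Irreflexive; Symmetric)
open import Relation.Binary.PropositionalEquality using (_≡_; _≢_)
open import Relation.Nullary.Decidable using (does; _⊎-dec_)

record Graph : Set₁ where
  field
    order      : ℕ
    Adj        : Rel (Fin order) 0ℓ
    adj?       : Decidable Adj
    adj-sym    : Symmetric Adj
    adj-irrefl : Irreflexive _≡_ Adj

  Vertex : Set
  Vertex = Fin order

  -- A Subset is a Boolean vector, so _≡_ between closed neighbourhoods
  -- means having the same elements.
  N[_] : Vertex → Subset order
  N[ v ] = tabulate λ w → does ((w ≟ v) ⊎-dec adj? v w)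

  Bipartite : Set
  Bipartite = Σ[ side ∈ (Vertex → Bool) ] (∀ u v → Adj u v → side u ≢ side v)

∑[_] : ∀ {n} → Subset n → (Fin n → ℕ) → ℕ
∑[ S ] f = sum +-0-commutativeMonoid λ w → if lookup S w then f w else 0

module _ (G : Graph) where
  open Graph G

  ClosedDistinguishing : (Vertex → ℕ) → Set
  ClosedDistinguishing f =
    ∀ u v → Adj u v → N[ u ] ≢ N[ v ] → ∑[ N[ u ] ] f ≢ ∑[ N[ v ] ] f

  HasClosedDistinguishingLabeling : ℕ → Set
  HasClosedDistinguishingLabeling k =
    Σ[ f ∈ (Vertex → ℕ) ] (∀ v → 1 ≤ f v × f v ≤ k) × ClosedDistinguishing f

-- The closed distinguishing number of G is given as a relation;
-- it holds for at most one k, by minimality.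
record dis[_]≡_ (G : Graph) (k : ℕ) : Set where
  field
    positive : 1 ≤ k
    attained : HasClosedDistinguishingLabeling G k
    minimal  : ∀ j → 1 ≤ j → HasClosedDistinguishingLabeling G j → k ≤ j

-- The graph has two classes of n base vertices and, for every pair of subsets
-- (A₀ , A₁) of the two classes, an edge u₀u₁ whose end uₛ is also joined to the
-- vertices of the subset of the opposite class. The closed neighbourhoods of u₀
-- and u₁ have equal sums as soon as A₀ and A₁ do. For labels at most t and
-- n = 2t + 1 such A₀ and A₁, not both empty, exist: walk along the prefix sums
-- of both classes, always advancing the one that is behind, so that their
-- difference stays in [-t , t]; by pigeonhole it repeats, and the labels
-- passed in between form two intervals of equal sum.

module Submission where

open import Defs
open import Algebra.Properties.CommutativeMonoid.Sum using (sum)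
open import Data.Bool using (Bool; true; false; not; T; if_then_else_; _∧_; _∨_; _xor_)
import Data.Bool.Properties as Bool
open import Data.Empty using (⊥-elim)
open import Data.Fin as Fin using (Fin; zero; suc; toℕ; fromℕ<; _↑ˡ_; _↑ʳ_; splitAt; finToFun; funToFin)
import Data.Fin.Properties as Fin
open import Data.Fin.Subset using (Subset)
open import Data.Nat using (ℕ; zero; suc; _+_; _*_; _∸_; _^_; _≤_; _<_; _≤?_; _<ᵇ_; z≤n; s≤s)
open import Data.Nat.Induction using (<-rec)
open import Data.Nat.Properties
open import Data.Product using (Σ-syntax; ∃; ∃-syntax; ∃₂; _×_; _,_; proj₁; proj₂)
open import Data.Sum using (_⊎_; inj₁; inj₂; [_,_])
open import Data.Unit using (tt)
open import Data.Vec using ([]; _∷_; lookup)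
open import Data.Vec.Properties using (≡-dec; lookup∘tabulate)
open import Function using (_∘_; Equivalence; Inverse)
open import Relation.Binary.PropositionalEquality hiding (J; [_])
open import Relation.Nullary using (¬_; yes; no; does; contradiction)
open import Relation.Nullary.Decidable using (map′; ¬?; _×-dec_; _→-dec_; T?; dec-true; dec-false)
open import Relation.Unary using (Pred; Decidable)
open import Level using (0ℓ)

open import Algebra.Properties.CommutativeMonoid.Sum +-0-commutativeMonoid
  using (sum-cong-≗; ∑-distrib-+; sum-replicate-zero)

-- Finite sums and least witnesses

∑ : ∀ {n} → (Fin n → ℕ) → ℕ
∑ = sum +-0-commutativeMonoid

_when_ : ℕ → Bool → ℕ
x when b = if b then x else 0

∑-↑ : ∀ m {n} (F : Fin (m + n) → ℕ) → ∑ F ≡ ∑ (λ i → F (i ↑ˡ n)) + ∑ (λ i → F (m ↑ʳ i))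
∑-↑ zero    F = refl
∑-↑ (suc m) {n} F = trans (cong (F zero +_) (∑-↑ m (F ∘ suc)))
  (sym (+-assoc (F zero) (∑ λ i → F (suc i ↑ˡ n)) (∑ λ i → F (suc m ↑ʳ i))))

∑-zero : ∀ {n} {F : Fin n → ℕ} → (∀ i → F i ≡ 0) → ∑ F ≡ 0
∑-zero {n} {F} F≡0 = trans (sum-cong-≗ F≡0) (sum-replicate-zero n)

∑-delta : ∀ {n} (v : Fin n) (f : Fin n → ℕ) → ∑ (λ w → f w when does (w Fin.≟ v)) ≡ f v
∑-delta {suc n} zero    f = trans (cong (f zero +_) (sum-replicate-zero n)) (+-identityʳ (f zero))
∑-delta {suc n} (suc v) f = ∑-delta v (f ∘ suc)

least : {P : Pred ℕ 0ℓ} → Decidable P → ∃ P → ∃[ k ] P k × (∀ j → P j → k ≤ j)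
least {P} P? (k , Pk) = <-rec (λ k → P k → _) search k Pk
  where
  search : ∀ k → (∀ {j} → j < k → P j → ∃[ k ] P k × (∀ j → P j → k ≤ j)) →
           P k → ∃[ k ] P k × (∀ j → P j → k ≤ j)
  search k rec Pk with anyUpTo? P? k
  ... | yes (j , j<k , Pj) = rec j<k Pj
  ... | no none            = k , Pk , λ j Pj → ≮⇒≥ λ j<k → none (j , j<k , Pj)

-- Existence of the closed distinguishing number

∑[]-cong : ∀ {n} (S : Subset n) {f g : Fin n → ℕ} → f ≗ g → ∑[ S ] f ≡ ∑[ S ] g
∑[]-cong S f≗g = sum-cong-≗ λ w → cong (_when lookup S w) (f≗g w)

∑[]-double : ∀ {n} (S : Subset n) (f : Fin n → ℕ) → ∑[ S ] (λ w → 2 * f w) ≡ 2 * ∑[ S ] f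
∑[]-double []          f = refl
∑[]-double (true ∷ S)  f = trans (cong (2 * f zero +_) (∑[]-double S (f ∘ suc)))
                                 (sym (*-distribˡ-+ 2 (f zero) (∑[ S ] (f ∘ suc))))
∑[]-double (false ∷ S) f = ∑[]-double S (f ∘ suc)

binary : ∀ {n} → Fin n → ℕ
binary w = 2 ^ toℕ w

-- The sum is the number whose binary digits are the entries of the subset: parity recovers the
-- first entry, and halving leaves the same problem for the tail.
∑[]-binary-injective : ∀ {n} (S T : Subset n) → ∑[ S ] binary ≡ ∑[ T ] binary → S ≡ T
∑[]-binary-injective []      []      _  = refl
∑[]-binary-injective (b ∷ S) (c ∷ T) eq = bits b c (subst₂ _≡_ (split b S) (split c T) eq)
  where
  split : ∀ {n} b (S : Subset n) → ∑[ b ∷ S ] binary ≡ (1 when b) + 2 * ∑[ S ] binary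
  split b S = cong ((1 when b) +_) (∑[]-double S binary)
  tails : 2 * ∑[ S ] binary ≡ 2 * ∑[ T ] binary → S ≡ T
  tails = ∑[]-binary-injective S T ∘ *-cancelˡ-≡ (∑[ S ] binary) (∑[ T ] binary) 2
  bits : ∀ b c → (1 when b) + 2 * ∑[ S ] binary ≡ (1 when c) + 2 * ∑[ T ] binary →
         b ∷ S ≡ c ∷ T
  bits true  true  eq = cong (true ∷_) (tails (suc-injective eq))
  bits true  false eq = ⊥-elim (even≢odd (∑[ T ] binary) (∑[ S ] binary) (sym eq))
  bits false true  eq = ⊥-elim (even≢odd (∑[ S ] binary) (∑[ T ] binary) eq)
  bits false false eq = cong (false ∷_) (tails eq)

module _ (G : Graph) where
  open Graph G

  -- Labelling by powers of two gives distinct subsets distinct sums, so it separates any two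
  -- different closed neighbourhoods.
  labeling-exists : HasClosedDistinguishingLabeling G (2 ^ order)
  labeling-exists = binary
    , (λ v → m^n>0 2 (toℕ v) , ^-monoʳ-≤ 2 (Fin.toℕ≤n v))
    , λ u v _ N≢ eq → N≢ (∑[]-binary-injective N[ u ] N[ v ] eq)

  closedDistinguishing? : Decidable (ClosedDistinguishing G)
  closedDistinguishing? f = Fin.all? λ u → Fin.all? λ v →
    adj? u v →-dec (¬? (≡-dec Bool._≟_ N[ u ] N[ v ]) →-dec ¬? (∑[ N[ u ] ] f ≟ ∑[ N[ v ] ] f))

  closedDistinguishing-cong : ∀ {f g} → f ≗ g →
                              ClosedDistinguishing G f → ClosedDistinguishing G g
  closedDistinguishing-cong f≗g dist u v uv N≢ eq = dist u v uv N≢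
    (trans (∑[]-cong N[ u ] f≗g) (trans eq (sym (∑[]-cong N[ v ] f≗g))))

  -- Only finitely many labelings use labels up to `k`. They are enumerated by `Fin (k ^ order)`,
  -- with each label lowered by one to lie in `Fin k`.
  labeling? : Decidable (HasClosedDistinguishingLabeling G)
  labeling? k = map′ decode encode (Fin.any? λ c → closedDistinguishing? (label c))
    where
    label : Fin (k ^ order) → Vertex → ℕ
    label c v = suc (toℕ (finToFun {k} {order} c v))
    decode : (∃[ c ] ClosedDistinguishing G (label c)) → HasClosedDistinguishingLabeling G k
    decode (c , dist) = label c , (λ v → s≤s z≤n , Fin.toℕ<n (finToFun {k} {order} c v)) , dist
    encode : HasClosedDistinguishingLabeling G k → ∃[ c ] ClosedDistinguishing G (label c)
    encode (f , bounds , dist) = funToFin g , closedDistinguishing-cong f≗label dist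
      where
      positive : ∀ v → suc (f v ∸ 1) ≡ f v
      positive v = m+[n∸m]≡n (proj₁ (bounds v))
      f-1<k : ∀ v → f v ∸ 1 < k
      f-1<k v = subst (_≤ k) (sym (positive v)) (proj₂ (bounds v))
      g : Vertex → Fin k
      g v = fromℕ< (f-1<k v)
      f≗label : f ≗ label (funToFin g)
      f≗label v = sym (trans (cong (suc ∘ toℕ) (Fin.finToFun-funToFin g v))
                             (trans (cong suc (Fin.toℕ-fromℕ< (f-1<k v))) (positive v)))

  dis-exists : ∃[ k ] dis[ G ]≡ k
  dis-exists with least (λ k → 1 ≤? k ×-dec labeling? k)
                        (2 ^ order , m^n>0 2 order , labeling-exists)
  ... | k , (1≤k , labeling) , minimal = k , record
    { positive = 1≤k ; attained = labeling ; minimal = λ j 1≤j lab → minimal j (1≤j , lab) }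

  no-labeling⇒dis> : ∀ t → (∀ k → k ≤ t → ¬ HasClosedDistinguishingLabeling G k) →
                     Σ[ k ∈ ℕ ] dis[ G ]≡ k × t < k
  no-labeling⇒dis> t none with dis-exists
  ... | k , dis = k , dis , ≰⇒> λ k≤t → none k k≤t (dis[_]≡_.attained dis)

  N-sum : ∀ v f → ∑[ N[ v ] ] f ≡ f v + ∑ (λ w → f w when does (adj? v w))
  N-sum v f = trans (sum-cong-≗ pointwise)
              (trans (∑-distrib-+ (λ w → f w when does (w Fin.≟ v)) (λ w → f w when does (adj? v w)))
                     (cong (_+ ∑ (λ w → f w when does (adj? v w))) (∑-delta v f)))
    where
    pointwise : ∀ w → f w when lookup N[ v ] w ≡
                      (f w when does (w Fin.≟ v)) + (f w when does (adj? v w))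
    pointwise w rewrite lookup∘tabulate (λ w → does (w Fin.≟ v) ∨ does (adj? v w)) w
      with w Fin.≟ v
    ... | no _     = refl
    -- Irreflexivity keeps `v` from being counted a second time as its own neighbour.
    ... | yes refl rewrite dec-false (adj? v v) (adj-irrefl refl) = sym (+-identityʳ _)

-- Intervals of equal sum

module Walk (t : ℕ) (P Q : ℕ → ℕ)
            (P-mono : ∀ i → P i ≤ P (suc i)) (P-step : ∀ i → P (suc i) ≤ t + P i)
            (Q-mono : ∀ j → Q j ≤ Q (suc j)) (Q-step : ∀ j → Q (suc j) ≤ t + Q j) where

  step : ℕ × ℕ → ℕ × ℕ
  step (i , j) with P i ≤? Q j
  ... | yes _ = suc i , j
  ... | no  _ = i , suc j

  walk : ℕ → ℕ × ℕ
  walk zero    = 0 , 0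
  walk (suc k) = step (walk k)

  I J : ℕ → ℕ
  I k = proj₁ (walk k)
  J k = proj₂ (walk k)

  Balanced : ℕ × ℕ → Set
  Balanced (i , j) = P i ≤ t + Q j × Q j ≤ t + P i

  -- The side that advances was not ahead, so a growth of at most `t` puts it at most `t` ahead. The
  -- other inequality survives by monotonicity.
  step-balanced : ∀ s → Balanced s → Balanced (step s)
  step-balanced (i , j) (p , q) with P i ≤? Q j
  ... | yes P≤Q = ≤-trans (P-step i) (+-monoʳ-≤ t P≤Q) , ≤-trans q (+-monoʳ-≤ t (P-mono i))
  ... | no  P≰Q = ≤-trans p (+-monoʳ-≤ t (Q-mono j)) , ≤-trans (Q-step j) (+-monoʳ-≤ t (≰⇒≥ P≰Q))

  step-total : ∀ s → proj₁ (step s) + proj₂ (step s) ≡ suc (proj₁ s + proj₂ s)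
  step-total (i , j) with P i ≤? Q j
  ... | yes _ = refl
  ... | no  _ = +-suc i j

  step-mono : ∀ s → proj₁ s ≤ proj₁ (step s) × proj₂ s ≤ proj₂ (step s)
  step-mono (i , j) with P i ≤? Q j
  ... | yes _ = n≤1+n i , ≤-refl
  ... | no  _ = ≤-refl , n≤1+n j

  module _ (start : Balanced (0 , 0)) where

    walk-balanced : ∀ k → Balanced (walk k)
    walk-balanced zero    = start
    walk-balanced (suc k) = step-balanced (walk k) (walk-balanced k)

    -- Each step advances exactly one index. Hence the time bounds both indices, and different times
    -- are at different positions.
    walk-total : ∀ k → I k + J k ≡ k
    walk-total zero    = refl
    walk-total (suc k) = trans (step-total (walk k)) (cong suc (walk-total k))

    walk-mono : ∀ k d → I k ≤ I (d + k) × J k ≤ J (d + k)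
    walk-mono k zero    = ≤-refl , ≤-refl
    walk-mono k (suc d) with walk-mono k d | step-mono (walk (d + k))
    ... | p , q | p′ , q′ = ≤-trans p p′ , ≤-trans q q′

    -- The difference of the prefix sums, shifted by `t` from [-t , t] into [0 , 2t]. Balance
    -- ensures that the truncated subtraction loses nothing.
    gap : ℕ → ℕ
    gap k = (t + P (I k)) ∸ Q (J k)

    gap< : ∀ k → gap k < suc (t + t)
    gap< k = s≤s (m≤n+o⇒m∸n≤o _ (Q (J k)) (begin
      t + P (I k)        ≤⟨ +-monoʳ-≤ t (proj₁ (walk-balanced k)) ⟩
      t + (t + Q (J k))  ≡⟨ sym (+-assoc t t _) ⟩
      t + t + Q (J k)    ≡⟨ +-comm (t + t) _ ⟩
      Q (J k) + (t + t)  ∎))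
      where open ≤-Reasoning

    gap-+ : ∀ k → gap k + Q (J k) ≡ t + P (I k)
    gap-+ k = m∸n+n≡m (proj₂ (walk-balanced k))

    -- Equality of the two differences, written without subtraction.
    gap-eq : ∀ k l → gap k ≡ gap l → P (I k) + Q (J l) ≡ P (I l) + Q (J k)
    gap-eq k l eq = +-cancelˡ-≡ t _ _ (begin
      t + (P (I k) + Q (J l))      ≡⟨ sym (+-assoc t _ _) ⟩
      t + P (I k) + Q (J l)        ≡⟨ cong (_+ Q (J l)) (sym (gap-+ k)) ⟩
      gap k + Q (J k) + Q (J l)    ≡⟨ cong (λ g → g + Q (J k) + Q (J l)) eq ⟩
      gap l + Q (J k) + Q (J l)    ≡⟨ +-assoc (gap l) _ _ ⟩
      gap l + (Q (J k) + Q (J l))  ≡⟨ cong (gap l +_) (+-comm (Q (J k)) _) ⟩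
      gap l + (Q (J l) + Q (J k))  ≡⟨ sym (+-assoc (gap l) _ _) ⟩
      gap l + Q (J l) + Q (J k)    ≡⟨ cong (_+ Q (J k)) (gap-+ l) ⟩
      t + P (I l) + Q (J k)        ≡⟨ +-assoc t _ _ ⟩
      t + (P (I l) + Q (J k))      ∎)
      where open ≡-Reasoning

    repetition : ∃₂ λ i i′ → ∃₂ λ j j′ →
      i ≤ i′ × j ≤ j′ × i′ ≤ suc (t + t) × j′ ≤ suc (t + t) × (i < i′ ⊎ j < j′) ×
      P i + Q j′ ≡ P i′ + Q j
    -- The 2t + 2 times from 0 to 2t + 1 share 2t + 1 possible gaps.
    repetition with Fin.pigeonhole (n<1+n (suc (t + t))) (λ k → fromℕ< (gap< (toℕ k)))
    ... | a , b , a<b , same = I k , I l , J k , J l , proj₁ mono , proj₂ mono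
        , ≤-trans (m≤m+n _ _) l≤ , ≤-trans (m≤n+m _ _) l≤ , advance , gap-eq k l gaps
      where
      k = toℕ a
      l = toℕ b
      mono : I k ≤ I l × J k ≤ J l
      mono = subst (λ x → I k ≤ I x × J k ≤ J x) (m∸n+n≡m (<⇒≤ a<b)) (walk-mono k (l ∸ k))
      l≤ : I l + J l ≤ suc (t + t)
      -- The later time is at most 2t + 1, so neither index passes the end of a class of that size.
      l≤ = subst (_≤ suc (t + t)) (sym (walk-total l)) (≤-pred (Fin.toℕ<n b))
      gaps : gap k ≡ gap l
      gaps = trans (sym (Fin.toℕ-fromℕ< (gap< k))) (trans (cong toℕ same) (Fin.toℕ-fromℕ< (gap< l)))
      advance : I k < I l ⊎ J k < J l
      advance with m≤n⇒m<n∨m≡n (proj₁ mono) | m≤n⇒m<n∨m≡n (proj₂ mono)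
      ... | inj₁ lt | _       = inj₁ lt
      ... | _       | inj₁ lt = inj₂ lt
      -- If neither index moved, the totals and therefore the two times would coincide.
      ... | inj₂ p  | inj₂ q  = contradiction
        (trans (sym (walk-total k)) (trans (cong₂ _+_ p q) (walk-total l))) (<⇒≢ a<b)

-- Prefix sums and intervals of a finite sequence

-- A cutoff inside a sum over all indices makes the prefix sum total in `k` and constant from `n`
-- on, so the hypotheses of `Walk` hold at every natural number.
prefix : ∀ {n} → (Fin n → ℕ) → ℕ → ℕ
prefix a k = ∑ λ x → a x when (toℕ x <ᵇ k)

prefix-mono : ∀ {n} (a : Fin n → ℕ) k → prefix a k ≤ prefix a (suc k)
prefix-mono {zero}  a k       = z≤n
prefix-mono {suc n} a zero    = m≤n+m _ (a zero)
prefix-mono {suc n} a (suc k) = +-monoʳ-≤ (a zero) (prefix-mono (a ∘ suc) k)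

prefix-step : ∀ {n t} (a : Fin n → ℕ) → (∀ x → a x ≤ t) → ∀ k → prefix a (suc k) ≤ t + prefix a k
prefix-step {zero}      a a≤t k       = z≤n
prefix-step {suc n}     a a≤t zero    = +-monoˡ-≤ _ (a≤t zero)
prefix-step {suc n} {t} a a≤t (suc k) = begin
  a zero + prefix (a ∘ suc) (suc k)    ≤⟨ +-monoʳ-≤ (a zero) (prefix-step (a ∘ suc) (a≤t ∘ suc) k) ⟩
  a zero + (t + prefix (a ∘ suc) k)    ≡⟨ sym (+-assoc (a zero) t _) ⟩
  a zero + t + prefix (a ∘ suc) k      ≡⟨ cong (_+ prefix (a ∘ suc) k) (+-comm (a zero) t) ⟩
  t + a zero + prefix (a ∘ suc) k      ≡⟨ +-assoc t (a zero) _ ⟩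
  t + (a zero + prefix (a ∘ suc) k)    ∎
  where open ≤-Reasoning

prefix-zero : ∀ {n} (a : Fin n → ℕ) → prefix a 0 ≡ 0
prefix-zero {n} a = sum-replicate-zero n

interval : ∀ {n} → ℕ → ℕ → Fin n → Bool
interval i i′ x = not (toℕ x <ᵇ i) ∧ (toℕ x <ᵇ i′)

prefix-interval : ∀ {n} (a : Fin n → ℕ) {i i′} → i ≤ i′ →
                  prefix a i + ∑ (λ x → a x when interval i i′ x) ≡ prefix a i′
prefix-interval a {i} {i′} i≤i′ = trans
  (sym (∑-distrib-+ (λ x → a x when (toℕ x <ᵇ i)) (λ x → a x when interval i i′ x)))
  (sum-cong-≗ pointwise)
  where
  pointwise : ∀ x → (a x when (toℕ x <ᵇ i)) + (a x when interval i i′ x) ≡ a x when (toℕ x <ᵇ i′)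
  pointwise x with toℕ x <ᵇ i in x<i | toℕ x <ᵇ i′ in x<i′
  ... | false | _     = refl
  ... | true  | true  = +-identityʳ _
  -- An index below `i` is also below `i′`, so this case cannot occur.
  ... | true  | false = ⊥-elim (subst T x<i′
    (<⇒<ᵇ (<-≤-trans (<ᵇ⇒< _ i (subst T (sym x<i) tt)) i≤i′)))

interval-nonempty : ∀ {n i i′} → i < i′ → i′ ≤ n → ∃[ x ] interval {n} i i′ x ≡ true
interval-nonempty {n} {i} {i′} i<i′ i′≤n = x , eq
  where
  i<n = <-≤-trans i<i′ i′≤n
  -- The lower endpoint `i` itself lies in the interval.
  x = fromℕ< i<n
  eq : interval i i′ x ≡ true
  eq rewrite Fin.toℕ-fromℕ< i<n | dec-false (T? (i <ᵇ i)) (n≮n i ∘ <ᵇ⇒< i i) =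
    Equivalence.to Bool.T-≡ (<⇒<ᵇ i<i′)

-- Here `x` and `y` are the increments from `p` to `p′` and from `q` to `q′`; the last hypothesis
-- equates them without subtraction.
+-transpose : ∀ {p p′ q q′ x y} → p + x ≡ p′ → q + y ≡ q′ → p + q′ ≡ p′ + q → x ≡ y
+-transpose {p} {q = q} {x = x} {y} refl refl eq = sym (+-cancelˡ-≡ (p + q) y x (begin
  p + q + y    ≡⟨ +-assoc p q y ⟩
  p + (q + y)  ≡⟨ eq ⟩
  p + x + q    ≡⟨ +-assoc p x q ⟩
  p + (x + q)  ≡⟨ cong (p +_) (+-comm x q) ⟩
  p + (q + x)  ≡⟨ sym (+-assoc p q x) ⟩
  p + q + x    ∎))
  where open ≡-Reasoning

equal-subsums : ∀ t (a : Bool → Fin (suc (t + t)) → ℕ) → (∀ s x → a s x ≤ t) →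
  Σ[ α ∈ (Bool → Fin (suc (t + t)) → Bool) ]
    (∃₂ λ s x → α s x ≡ true) ×
    ∑ (λ x → a false x when α false x) ≡ ∑ (λ x → a true x when α true x)
equal-subsums t a a≤t = from-repetition (Walk.repetition t P Q
    (prefix-mono (a false)) (prefix-step (a false) (a≤t false))
    (prefix-mono (a true)) (prefix-step (a true) (a≤t true))
    -- The walk starts balanced because both empty prefixes have sum 0.
    (subst (_≤ t + Q 0) (sym (prefix-zero (a false))) z≤n ,
     subst (_≤ t + P 0) (sym (prefix-zero (a true))) z≤n))
  where
  P Q : ℕ → ℕ
  P = prefix (a false)
  Q = prefix (a true)
  from-repetition : (∃₂ λ i i′ → ∃₂ λ j j′ →
    i ≤ i′ × j ≤ j′ × i′ ≤ suc (t + t) × j′ ≤ suc (t + t) × (i < i′ ⊎ j < j′) ×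
    P i + Q j′ ≡ P i′ + Q j) → _
  from-repetition (i , i′ , j , j′ , i≤i′ , j≤j′ , i′≤n , j′≤n , advance , eq) =
    α , nonempty advance ,
    +-transpose {P i} {P i′} {Q j} {Q j′}
      (prefix-interval (a false) i≤i′) (prefix-interval (a true) j≤j′) eq
    where
    α : Bool → Fin (suc (t + t)) → Bool
    α false = interval i i′
    α true  = interval j j′
    nonempty : i < i′ ⊎ j < j′ → ∃₂ λ s x → α s x ≡ true
    nonempty (inj₁ lt) = false , interval-nonempty lt i′≤n
    nonempty (inj₂ lt) = true , interval-nonempty lt j′≤n

-- The gadget graph

data Node (n m : ℕ) : Set where
  base   : Bool → Fin n → Node n m
  gadget : Bool → Fin m → Node n m

module Gadgets {n m : ℕ} (I : Bool → Fin m → Fin n → Bool) where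

  side : Node n m → Bool
  side (base s _)   = s
  side (gadget s _) = s

  -- Sides are ignored here and enforced in `joined`. There a gadget end on one side meets only the
  -- base vertices of the other class that lie in the gadget's subset, and the other end of the same
  -- gadget.
  link : Node n m → Node n m → Bool
  link (base _ _)   (base _ _)    = false
  link (base s x)   (gadget _ g)  = I s g x
  link (gadget _ g) (base s x)    = I s g x
  link (gadget _ g) (gadget _ g′) = does (g′ Fin.≟ g)

  joined : Node n m → Node n m → Bool
  joined p q = (side p xor side q) ∧ link p q

  does-≟-sym : ∀ {k} (g h : Fin k) → does (g Fin.≟ h) ≡ does (h Fin.≟ g)
  does-≟-sym zero    zero    = refl
  does-≟-sym zero    (suc h) = refl
  does-≟-sym (suc g) zero    = refl
  does-≟-sym (suc g) (suc h) = does-≟-sym g h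

  link-sym : ∀ p q → link p q ≡ link q p
  link-sym (base _ _)   (base _ _)    = refl
  link-sym (base _ _)   (gadget _ _)  = refl
  link-sym (gadget _ _) (base _ _)    = refl
  link-sym (gadget _ g) (gadget _ g′) = does-≟-sym g′ g

  joined-sym : ∀ p q → joined p q ≡ joined q p
  joined-sym p q = cong₂ _∧_ (Bool.xor-comm (side p) (side q)) (link-sym p q)

  joined⇒opposite : ∀ p q → T (joined p q) → side p ≢ side q
  joined⇒opposite p q pq eq with side p | side q
  joined⇒opposite p q () refl | true  | _
  joined⇒opposite p q () refl | false | _

  -- The `false` half comes first, and within each half the base vertices precede the gadget ends.
  decode : Fin ((n + m) + (n + m)) → Node n m
  decode i = [ half false , half true ] (splitAt (n + m) i)
    where
    half : Bool → Fin (n + m) → Node n m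
    half s = [ base s , gadget s ] ∘ splitAt n

  place : Bool → Fin (n + m) → Fin ((n + m) + (n + m))
  place false i = i ↑ˡ (n + m)
  place true  i = (n + m) ↑ʳ i

  encode : Node n m → Fin ((n + m) + (n + m))
  encode (base s x)   = place s (x ↑ˡ m)
  encode (gadget s g) = place s (n ↑ʳ g)

  decode-encode : ∀ p → decode (encode p) ≡ p
  decode-encode (base false x)   rewrite Fin.splitAt-↑ˡ (n + m) (x ↑ˡ m) (n + m) | Fin.splitAt-↑ˡ n x m = refl
  decode-encode (base true x)    rewrite Fin.splitAt-↑ʳ (n + m) (n + m) (x ↑ˡ m) | Fin.splitAt-↑ˡ n x m = refl
  decode-encode (gadget false g) rewrite Fin.splitAt-↑ˡ (n + m) (n ↑ʳ g) (n + m) | Fin.splitAt-↑ʳ n m g = refl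
  decode-encode (gadget true g)  rewrite Fin.splitAt-↑ʳ (n + m) (n + m) (n ↑ʳ g) | Fin.splitAt-↑ʳ n m g = refl

  graph : Graph
  graph = record
    { order      = (n + m) + (n + m)
    ; Adj        = λ i j → T (joined (decode i) (decode j))
    ; adj?       = λ i j → T? (joined (decode i) (decode j))
    ; adj-sym    = λ {i} {j} → subst T (joined-sym (decode i) (decode j))
    ; adj-irrefl = λ { {i} refl ii → joined⇒opposite (decode i) (decode i) ii refl }
    }

  open Graph graph using (Vertex; N[_]; Adj; Bipartite)

  bipartite : Bipartite
  bipartite = side ∘ decode , λ i j → joined⇒opposite (decode i) (decode j)

  -- Closed neighbourhoods in the gadget graph

  joined-encode : ∀ p q → joined (decode (encode p)) (decode (encode q)) ≡ joined p q
  joined-encode p q = cong₂ joined (decode-encode p) (decode-encode q)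

  N-lookup : ∀ p q → p ≢ q → lookup N[ encode p ] (encode q) ≡ joined p q
  N-lookup p q p≢q
    rewrite lookup∘tabulate (λ w → does (w Fin.≟ encode p) ∨ joined (decode (encode p)) (decode w)) (encode q)
          -- `encode` is injective because `decode` inverts it, so only adjacency is left of the
          -- membership test.
          | dec-false (encode q Fin.≟ encode p)
              (λ eq → p≢q (trans (sym (decode-encode p)) (trans (cong decode (sym eq)) (decode-encode q))))
    = joined-encode p q

  half-sum : Bool → (Vertex → ℕ) → ℕ
  half-sum s F = ∑ (λ x → F (encode (base s x))) + ∑ (λ g → F (encode (gadget s g)))

  ∑-halves : ∀ s F → ∑ F ≡ half-sum s F + half-sum (not s) F
  ∑-halves s F = trans (∑-↑ (n + m) F) (trans (cong₂ _+_ (∑-↑ n (F ∘ place false)) (∑-↑ n (F ∘ place true))) (order s))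
    where
    order : ∀ s → half-sum false F + half-sum true F ≡ half-sum s F + half-sum (not s) F
    order false = refl
    order true  = +-comm (half-sum false F) (half-sum true F)

  module _ (f : Vertex → ℕ) where

    subset-sum : Bool → Fin m → ℕ
    subset-sum s g = ∑ λ x → f (encode (base s x)) when I s g x

    -- A gadget end has no neighbour in its own half; the opposite half contributes the chosen base
    -- vertices and the partner end.
    gadget-sum : ∀ s g → ∑[ N[ encode (gadget s g) ] ] f ≡
      f (encode (gadget s g)) + (subset-sum (not s) g + f (encode (gadget (not s) g)))
    gadget-sum s g = trans (N-sum graph u f) (cong (f u +_)
      (trans (∑-halves s F) (cong₂ _+_ (same s F-encode) (opposite s F-encode))))
      where
      u = encode (gadget s g)
      F : Vertex → ℕ
      F w = f w when joined (decode u) (decode w)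
      F-encode : ∀ q → F (encode q) ≡ f (encode q) when joined (gadget s g) q
      F-encode q = cong (f (encode q) when_) (joined-encode (gadget s g) q)
      -- The equation for `F` is passed as an argument so that matching on `s` lets `joined` reduce.
      same : ∀ s → (∀ q → F (encode q) ≡ f (encode q) when joined (gadget s g) q) →
             half-sum s F ≡ 0
      same false F≡ = cong₂ _+_ (∑-zero (F≡ ∘ base false)) (∑-zero (F≡ ∘ gadget false))
      same true  F≡ = cong₂ _+_ (∑-zero (F≡ ∘ base true)) (∑-zero (F≡ ∘ gadget true))
      opposite : ∀ s → (∀ q → F (encode q) ≡ f (encode q) when joined (gadget s g) q) →
                 half-sum (not s) F ≡ subset-sum (not s) g + f (encode (gadget (not s) g))
      opposite false F≡ = cong₂ _+_ (sum-cong-≗ (F≡ ∘ base true))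
        (trans (sum-cong-≗ (F≡ ∘ gadget true)) (∑-delta g (f ∘ encode ∘ gadget true)))
      opposite true  F≡ = cong₂ _+_ (sum-cong-≗ (F≡ ∘ base false))
        (trans (sum-cong-≗ (F≡ ∘ gadget false)) (∑-delta g (f ∘ encode ∘ gadget false)))

    -- Both neighbourhoods contain both ends of the gadget, so their sums can differ only in the
    -- subset sums.
    gadget-sums-equal : ∀ g → subset-sum false g ≡ subset-sum true g →
      ∑[ N[ encode (gadget false g) ] ] f ≡ ∑[ N[ encode (gadget true g) ] ] f
    gadget-sums-equal g eq = begin
      ∑[ N[ encode (gadget false g) ] ] f  ≡⟨ gadget-sum false g ⟩
      f₀ + (subset-sum true g + f₁)        ≡⟨ cong (λ z → f₀ + (z + f₁)) (sym eq) ⟩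
      f₀ + (subset-sum false g + f₁)       ≡⟨ sym (+-assoc f₀ (subset-sum false g) f₁) ⟩
      f₀ + subset-sum false g + f₁         ≡⟨ +-comm (f₀ + subset-sum false g) f₁ ⟩
      f₁ + (f₀ + subset-sum false g)       ≡⟨ cong (f₁ +_) (+-comm f₀ (subset-sum false g)) ⟩
      f₁ + (subset-sum false g + f₀)       ≡⟨ sym (gadget-sum true g) ⟩
      ∑[ N[ encode (gadget true g) ] ] f   ∎
      where
      open ≡-Reasoning
      f₀ = f (encode (gadget false g))
      f₁ = f (encode (gadget true g))

  gadgets-adjacent : ∀ g → Adj (encode (gadget false g)) (encode (gadget true g))
  gadgets-adjacent g = subst T (sym (trans (joined-encode (gadget false g) (gadget true g))
                                           (dec-true (g Fin.≟ g) refl))) tt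

  -- A base vertex in one of the gadget's subsets is adjacent to exactly one of the two ends, the
  -- one on the opposite side.
  N-gadgets-distinct : ∀ g → (∃₂ λ s x → I s g x ≡ true) →
                       N[ encode (gadget false g) ] ≢ N[ encode (gadget true g) ]
  N-gadgets-distinct g (s , x , x∈I) eq = separate s x∈I (begin
    joined (gadget false g) (base s x)                    ≡⟨ sym (N-lookup (gadget false g) (base s x) λ ()) ⟩
    lookup N[ encode (gadget false g) ] (encode (base s x))  ≡⟨ cong (λ N → lookup N (encode (base s x))) eq ⟩
    lookup N[ encode (gadget true g) ] (encode (base s x))   ≡⟨ N-lookup (gadget true g) (base s x) (λ ()) ⟩
    joined (gadget true g) (base s x)                     ∎)
    where
    open ≡-Reasoning
    separate : ∀ s → I s g x ≡ true → joined (gadget false g) (base s x) ≢ joined (gadget true g) (base s x)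
    separate false x∈I eq = contradiction (trans eq x∈I) λ ()
    separate true  x∈I eq = contradiction (trans (sym eq) x∈I) λ ()

-- A gadget index codes a pair of subsets, as a 0-1 function on both classes.
module _ {n : ℕ} where

  class : Bool → Fin n → Fin (n + n)
  class false x = x ↑ˡ n
  class true  x = n ↑ʳ x

  subset : Bool → Fin (2 ^ (n + n)) → Fin n → Bool
  subset s g x = Inverse.to Fin.2↔Bool (finToFun {2} {n + n} g (class s x))

  code : (Bool → Fin n → Bool) → Fin (2 ^ (n + n))
  code α = funToFin (Inverse.from Fin.2↔Bool ∘ [ α false , α true ] ∘ splitAt n)

  subset-code : ∀ α s x → subset s (code α) x ≡ α s x
  subset-code α s x = trans (cong (Inverse.to Fin.2↔Bool) (Fin.finToFun-funToFin _ (class s x)))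
    (trans (Inverse.strictlyInverseˡ Fin.2↔Bool _) (split s))
    where
    split : ∀ s → [ α false , α true ] (splitAt n (class s x)) ≡ α s x
    split false = cong [ α false , α true ] (Fin.splitAt-↑ˡ n x n)
    split true  = cong [ α false , α true ] (Fin.splitAt-↑ʳ n n x)

  open Gadgets subset

  -- Every pair of subsets has its own gadget, so the pair `α` found from `f` indexes an edge at
  -- which `f` fails.
  equal-subsums⇒¬distinguishing : ∀ f (α : Bool → Fin n → Bool) → (∃₂ λ s x → α s x ≡ true) →
    ∑ (λ x → f (encode (base false x)) when α false x) ≡
      ∑ (λ x → f (encode (base true x)) when α true x) →
    ¬ ClosedDistinguishing graph f
  equal-subsums⇒¬distinguishing f α (s , x , x∈α) sums dist =
    dist (encode (gadget false g)) (encode (gadget true g)) (gadgets-adjacent g)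
      (N-gadgets-distinct g (s , x , trans (subset-code α s x) x∈α))
      (gadget-sums-equal f g (trans (decoded false) (trans sums (sym (decoded true)))))
    where
    g = code α
    decoded : ∀ s → subset-sum f s g ≡ ∑ (λ x → f (encode (base s x)) when α s x)
    decoded s = sum-cong-≗ λ x → cong (f (encode (base s x)) when_) (subset-code α s x)

-- Graphs of arbitrarily large closed distinguishing number

no-small-labeling : ∀ t k → k ≤ t →
  ¬ HasClosedDistinguishingLabeling (Gadgets.graph (subset {suc (t + t)})) k
no-small-labeling t k k≤t (f , bounds , dist) =
  let α , nonempty , sums = equal-subsums t (λ s x → f (encode (base s x)))
        (λ s x → ≤-trans (proj₂ (bounds (encode (base s x)))) k≤t)
  in equal-subsums⇒¬distinguishing f α nonempty sums dist
  where open Gadgets (subset {suc (t + t)}) using (encode)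

-- Opened only here because +_ clashes with the sections of _+_.
open import Data.Integer using (ℤ; +_; -[1+_]; _>_; +<+; -<+)

theorem6 : (t : ℤ) →
    Σ[ G ∈ Graph ] Graph.Bipartite G × (Σ[ k ∈ ℕ ] dis[ G ]≡ k × + k > t)
theorem6 (+ t) = large-graph , Gadgets.bipartite (subset {suc (t + t)}) ,
  let k , dis , t<k = no-labeling⇒dis> large-graph t (no-small-labeling t) in k , dis , +<+ t<k
  where
  large-graph = Gadgets.graph (subset {suc (t + t)})
-- For negative `t` the graph built for 0 serves, since every natural number exceeds `t`.
theorem6 -[1+ _ ] =
  let G , bip , k , dis , _ = theorem6 (+ 0) in G , bip , k , dis , -<+
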